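{- Let $m\geqslant 3$ be an integer. If $n$ is an integer with $n \geqslant 2m^3 - \frac{1}{2}m^2 - m + 1$, then the complete bipartite graph $K_{m,n}$ does not belong to $B_{2m-3}^{m}$, i.e. $K_{m,n}$ has no monotonic $(2m-3)$-bend EPG representation. (In the symbol $B_{\ell}^{m}$ the superscript $m$ stands for "monotonic" and is not the integer $m$.)
   Context: All graphs are finite and simple. $K_{m,n}$ is the complete bipartite graph with partition classes of sizes $m$ and $n$. A grid consists of horizontal grid lines (rows, increasing from bottom to top) and vertical grid lines (columns, increasing from left to right). A grid point is a crossing of two grid lines. A grid edge is the part of a grid line between two consecutive grid points. A path on a grid consists of two grid points (its end points) and a number of consecutive grid edges connecting them. A bend of a path is a turn of the path at a grid point. An EPG representation of a graph $G$ assigns to each vertex $v$ of $G$ a path $P_v$ on a common grid such that two distinct vertices $v,w$ are adjacent in $G$ if and only if $P_v$ and $P_w$ share at least one grid edge. A path is monotonic if it is ascending in both columns and rows, i.e. it has the shape of a staircase going upwards from left to right. For a nonnegative integer $\ell$, $B_\ell^m$ (the superscript $m$ is just a symbol for "monotonic") is the class of all graphs that have an EPG representation in which every path is monotonic and has at most $\ell$ bends. -}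

module Defs where

open import Data.Empty using (⊥)
open import Data.Fin using (Fin)
open import Data.Fin.Properties using (+↔⊎)
open import Data.List using (List; []; _∷_)
open import Data.List.Membership.Propositional using (_∈_)
open import Data.Nat using (ℕ; suc; _+_; _≤_)
open import Data.Product using (Σ; ∃; _×_; _,_)
open import Data.Sum using (_⊎_; inj₁; inj₂)
open import Data.Unit using (⊤)
open import Function.Bundles using (_⇔_; _↔_)
open import Function.Construct.Symmetry using (↔-sym)
open import Level using (0ℓ)
open import Relation.Binary.Construct.Closure.ReflexiveTransitive using (Star; ε; _◅_)
open import Relation.Binary.PropositionalEquality using (_≢_)
open import Relation.Nullary using (¬_)
open import Relation.Unary using (Pred)

record Graph : Set₁ where
  field
    Vertex  : Set
    order   : ℕ
    finite  : Vertex ↔ Fin order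
    Adj     : Vertex → Vertex → Set
    symm    : ∀ {v w} → Adj v w → Adj w v
    irrefl  : ∀ {v} → ¬ Adj v v

K-Adj : ∀ {m n} → Fin m ⊎ Fin n → Fin m ⊎ Fin n → Set
K-Adj (inj₁ _) (inj₁ _) = ⊥
K-Adj (inj₁ _) (inj₂ _) = ⊤
K-Adj (inj₂ _) (inj₁ _) = ⊤
K-Adj (inj₂ _) (inj₂ _) = ⊥

K-symm : ∀ {m n} (v w : Fin m ⊎ Fin n) → K-Adj v w → K-Adj w v
K-symm (inj₁ _) (inj₂ _) a = a
K-symm (inj₂ _) (inj₁ _) a = a

K-irrefl : ∀ {m n} (v : Fin m ⊎ Fin n) → ¬ K-Adj v v
K-irrefl (inj₁ _) ()
K-irrefl (inj₂ _) ()

K : ℕ → ℕ → Graph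
K m n = record
  { Vertex = Fin m ⊎ Fin n
  ; order  = m + n
  ; finite = ↔-sym +↔⊎
  ; Adj    = K-Adj
  ; symm   = λ {v} {w} → K-symm v w
  ; irrefl = λ {v} → K-irrefl v
  }

-- A grid point is a pair (column , row).  The grid is the quarter plane
-- ℕ × ℕ: every finite grid embeds in it, and finitely many paths only ever
-- use a finite part of it.

Point : Set
Point = ℕ × ℕ

-- An (undirected) grid edge, named by its left, respectively lower, end.

data Edge : Set where
  horizontal vertical : Point → Edge

data Step : Point → Point → Set where
  right : ∀ {x y} → Step (x , y) (suc x , y)
  left  : ∀ {x y} → Step (suc x , y) (x , y)
  up    : ∀ {x y} → Step (x , y) (x , suc y)
  down  : ∀ {x y} → Step (x , suc y) (x , y)

edge : ∀ {p q} → Step p q → Edge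
edge (right {x} {y}) = horizontal (x , y)
edge (left  {x} {y}) = horizontal (x , y)
edge (up    {x} {y}) = vertical   (x , y)
edge (down  {x} {y}) = vertical   (x , y)

Path : Point → Point → Set
Path = Star Step

edges : ∀ {p q} → Path p q → List Edge
edges ε       = []
edges (s ◅ π) = edge s ∷ edges π

-- 1 if a path passing from the first edge to the second turns there.

turn : Edge → Edge → ℕ
turn (horizontal _) (horizontal _) = 0
turn (horizontal _) (vertical   _) = 1
turn (vertical   _) (horizontal _) = 1
turn (vertical   _) (vertical   _) = 0

turns : List Edge → ℕ
turns []           = 0
turns (_ ∷ [])     = 0
turns (e ∷ f ∷ es) = turn e f + turns (f ∷ es)

bends : ∀ {p q} → Path p q → ℕ
bends π = turns (edges π)

data Ascending : ∀ {p q} → Step p q → Set where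
  right : ∀ {x y} → Ascending (right {x} {y})
  up    : ∀ {x y} → Ascending (up {x} {y})

-- A path carries no orientation in the EPG setting, so a monotonic path is
-- always taken to be traversed from its lower left end point; reversing a
-- path affects neither its edges nor its number of bends.

Monotonic : ∀ {p q} → Path p q → Set
Monotonic ε       = ⊤
Monotonic (s ◅ π) = Ascending s × Monotonic π

ShareEdge : ∀ {p q p′ q′} → Path p q → Path p′ q′ → Set
ShareEdge π ρ = ∃ λ e → e ∈ edges π × e ∈ edges ρ

record EPGRepresentation (G : Graph) : Set where
  open Graph G
  field
    source target : Vertex → Point
    path          : ∀ v → Path (source v) (target v)
    adj⇔share     : ∀ {v w} → v ≢ w → Adj v w ⇔ ShareEdge (path v) (path w)

-- The superscript is the letter m for "monotonic", not a parameter.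

Bᵐ : ℕ → Pred Graph 0ℓ
Bᵐ ℓ G = Σ (EPGRepresentation G) λ R → let open EPGRepresentation R in
  ∀ v → Monotonic (path v) × bends (path v) ≤ ℓ

-- Cut every path into its at most 2m − 2 maximal straight segments, numbered
-- from 0.  Each of the n paths b meets all m paths a, so by pigeonhole two
-- paths a ≠ a′ share edges with b on the same or on consecutive segments of b.
-- Walking along b from one to the other, either b runs straight on past the
-- last edge of a segment of a, or it runs straight into the first edge of a
-- segment of a′, or it bends at a point where it passes from a to a′.
--
-- As the paths b are edge-disjoint, each of these events determines b.  The
-- first two are indexed by a path and one of its segments: 2 · m(2m − 2) cases.
-- For the third, with b bending from segment i of a to segment j of a′, the
-- triple (a , a′ , i + j) suffices: two such bends with i < i′ and j > j′ would
-- lie both after and before each other.  The parity of i + j is odd exactly if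
-- a and a′ start in the same direction, which leaves 2m − 3 values for i + j
-- then, and 2m − 2 otherwise.  If k paths a start horizontally and l
-- vertically, this gives m(m − 1)(2m − 3) + 2kl cases, where 4kl ≤ m².

module Submission where

open import Data.Fin using (Fin; toℕ; fromℕ<; punchIn; punchOut)
open import Data.Fin.Properties using (pigeonhole; punchIn-punchOut; toℕ-fromℕ<)
  renaming (_≟_ to _≟ᶠ_; <⇒≢ to <⇒≢ᶠ)
open import Data.Integer using (+_)
import Data.Integer as ℤ
import Data.Integer.Properties as ℤ
open import Data.Integer.Tactic.RingSolver using () renaming (solve-∀ to solveℤ-∀)
open import Data.List using (List; []; _∷_; _++_; length; map; filter; lookup; upTo; allFin; cartesianProduct; cartesianProductWith)
open import Data.List.Membership.Propositional using (_∈_) renaming (_∉_ to _∉ˡ_)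
import Data.List.Membership.DecPropositional as DecMembership
open import Data.List.Membership.Propositional.Properties
  using (∈-++⁺ˡ; ∈-++⁺ʳ; ∈-allFin; ∈-upTo⁺; ∈-filter⁺; ∈-map⁺; ∈-cartesianProduct⁺; ∈-cartesianProductWith⁺)
open import Data.List.Properties using (length-++; length-map; length-upTo; length-tabulate)
open import Data.List.Relation.Unary.Any using (here; there; index)
open import Data.List.Relation.Unary.Any.Properties using (lookup-index)
open import Data.List.Relation.Unary.Linked using (Linked; []; [-]; _∷_)
import Data.Nat as ℕ
open import Data.Nat using (ℕ; suc; parity; ⌊_/2⌋; _≤_; _<_; _≮_; z≤n; s≤s; _*_; _^_; _∸_; _≥_)
open import Data.Nat.Properties
open import Data.Nat.Tactic.RingSolver using (solve-∀)
open import Data.Parity using (Parity; 0ℙ; 1ℙ; _⁻¹) renaming (_+_ to _⊕_)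
import Data.Parity.Properties as ℙ
open import Data.Product using (∃; Σ; _×_; _,_; proj₁; proj₂)
open import Data.Product.Properties using (≡-dec)
open import Data.Rational.Unnormalised using (_/_; _-_; _+_; 1ℚᵘ; ↥_) renaming (_≥_ to _≥ℚ_)
open import Data.Rational.Unnormalised.Properties using (drop-*≤*)
open import Data.Sum using (_⊎_; inj₁; inj₂)
open import Data.Sum.Properties using (inj₂-injective; inj₁-injective)
open import Data.Unit using (tt)
open import Function using (_∘_)
open import Function.Bundles using (Equivalence)
open import Relation.Binary.Construct.Closure.ReflexiveTransitive using (ε; _◅_)
open import Relation.Binary.PropositionalEquality
open import Relation.Binary.Definitions using (tri<; tri≈; tri>)
open import Relation.Nullary using (Dec; ¬_; yes; no; contradiction)
open import Relation.Nullary.Decidable using (map′)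
open import Relation.Unary using (_∉_)
open import Defs

private variable
  x y n : ℕ
  e f e′ f′ : Edge
  es as as′ bs : List Edge

-- Edges, lines and staircases.

direction : Edge → Parity
direction (horizontal _) = 0ℙ
direction (vertical   _) = 1ℙ

line : Edge → Parity × ℕ
line (horizontal (x , y)) = 0ℙ , y
line (vertical   (x , y)) = 1ℙ , x

-- Increases by one with every edge of a monotonic path, so that the order
-- along such a path can be read off from it.
height : Edge → ℕ
height (horizontal (x , y)) = x ℕ.+ y
height (vertical   (x , y)) = x ℕ.+ y

succ : Edge → Edge
succ (horizontal (x , y)) = horizontal (suc x , y)
succ (vertical   (x , y)) = vertical   (x , suc y)

succ-injective : succ e ≡ succ f → e ≡ f
succ-injective {horizontal _} {horizontal _} refl = refl
succ-injective {vertical _}   {vertical _}   refl = refl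

infix 4 _≟ᵉ_ _↝_

_≟ᵉ_ : (e f : Edge) → Dec (e ≡ f)
horizontal p ≟ᵉ horizontal q = map′ (cong horizontal) (λ { refl → refl }) (≡-dec _≟_ _≟_ p q)
horizontal p ≟ᵉ vertical   q = no λ ()
vertical   p ≟ᵉ horizontal q = no λ ()
vertical   p ≟ᵉ vertical   q = map′ (cong vertical) (λ { refl → refl }) (≡-dec _≟_ _≟_ p q)

open DecMembership _≟ᵉ_ using (_∈?_)

-- Succession along a monotonic path, stated on edges alone, so that after `edges-staircase` only
-- edge lists are handled.
data _↝_ : Edge → Edge → Set where
  right-right : horizontal (x , y) ↝ horizontal (suc x , y)
  right-up    : horizontal (x , y) ↝ vertical   (suc x , y)
  up-right    : vertical   (x , y) ↝ horizontal (x , suc y)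
  up-up       : vertical   (x , y) ↝ vertical   (x , suc y)

Staircase : List Edge → Set
Staircase = Linked _↝_

edges-staircase : ∀ {p q} (π : Path p q) → Monotonic π → Staircase (edges π)
edges-staircase ε             _                         = []
edges-staircase (_ ◅ ε)       _                         = [-]
edges-staircase (_ ◅ π@(_ ◅ _)) (right , mono@(right , _)) = right-right ∷ edges-staircase π mono
edges-staircase (_ ◅ π@(_ ◅ _)) (right , mono@(up , _))    = right-up    ∷ edges-staircase π mono
edges-staircase (_ ◅ π@(_ ◅ _)) (up , mono@(right , _))    = up-right    ∷ edges-staircase π mono
edges-staircase (_ ◅ π@(_ ◅ _)) (up , mono@(up , _))       = up-up       ∷ edges-staircase π mono

height-↝ : e ↝ f → height f ≡ suc (height e)
height-↝ right-right          = refl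
height-↝ right-up             = refl
height-↝ (up-right {x} {y})   = +-suc x y
height-↝ (up-up {x} {y})      = +-suc x y

straight : e ↝ f → turn e f ≡ 0 → f ≡ succ e
straight right-right _ = refl
straight up-up       _ = refl

turn≤1 : ∀ e f → turn e f ≤ 1
turn≤1 (horizontal _) (horizontal _) = z≤n
turn≤1 (horizontal _) (vertical   _) = ≤-refl
turn≤1 (vertical   _) (horizontal _) = ≤-refl
turn≤1 (vertical   _) (vertical   _) = z≤n

turn-parity : ∀ e f → parity (turn e f) ≡ direction e ⊕ direction f
turn-parity (horizontal _) (horizontal _) = refl
turn-parity (horizontal _) (vertical   _) = refl
turn-parity (vertical   _) (horizontal _) = refl
turn-parity (vertical   _) (vertical   _) = refl

line-succ : ∀ e → line (succ e) ≡ line e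
line-succ (horizontal _) = refl
line-succ (vertical   _) = refl

-- Numbering the straight segments of a staircase.

segment : e ∈ es → ℕ
segment (here _)                  = 0
segment {es = e ∷ f ∷ _} (there p) = turn e f ℕ.+ segment p

segment≤turns : (p : e ∈ es) → segment p ≤ turns es
segment≤turns (here _)                    = z≤n
segment≤turns {es = e ∷ f ∷ _} (there p) = +-monoʳ-≤ (turn e f) (segment≤turns p)

initial : List Edge → Parity
initial []      = 0ℙ
initial (e ∷ _) = direction e

-- Every turn switches the direction, so the parities of the turns telescope.
segment-parity : (p : e ∈ es) → parity (segment p) ≡ initial es ⊕ direction e
segment-parity {e = e} (here refl) with direction e
... | 0ℙ = refl
... | 1ℙ = refl
segment-parity {e = g} {es = e ∷ f ∷ _} (there p) = begin
  parity (turn e f ℕ.+ segment p)                            ≡⟨ ℙ.+-homo-+ (turn e f) (segment p) ⟩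
  parity (turn e f) ⊕ parity (segment p)                     ≡⟨ cong₂ _⊕_ (turn-parity e f) (segment-parity p) ⟩
  (direction e ⊕ direction f) ⊕ (direction f ⊕ direction g)  ≡⟨ cancel (direction e) (direction f) ⟩
  direction e ⊕ direction g                                  ∎
  where
  open ≡-Reasoning
  cancel : ∀ a b {c} → (a ⊕ b) ⊕ (b ⊕ c) ≡ a ⊕ c
  cancel 0ℙ 0ℙ = refl
  cancel 0ℙ 1ℙ {0ℙ} = refl
  cancel 0ℙ 1ℙ {1ℙ} = refl
  cancel 1ℙ 0ℙ = refl
  cancel 1ℙ 1ℙ {0ℙ} = refl
  cancel 1ℙ 1ℙ {1ℙ} = refl

head-lowest : Staircase (e ∷ es) → f ∈ es → height e < height f
head-lowest (r ∷ _)  (here refl) = ≤-reflexive (sym (height-↝ r))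
head-lowest (r ∷ rs) (there q)   = <-trans (≤-reflexive (sym (height-↝ r))) (head-lowest rs q)

-- Heights increase strictly along a staircase, so `e` does not come after `f` and no more turns
-- precede it.
segment-mono : Staircase es → (p : e ∈ es) (q : f ∈ es) → height e ≤ height f → segment p ≤ segment q
segment-mono _  (here _)  _           _  = z≤n
segment-mono rs (there p) (here refl) le = contradiction le (<⇒≱ (head-lowest rs p))
segment-mono (_∷_ {x = e} {y = f} r rs) (there p) (there q) le = +-monoʳ-≤ (turn e f) (segment-mono rs p q le)

head-line : Staircase (e ∷ es) → (q : f ∈ e ∷ es) → segment q ≡ 0 → line f ≡ line e
head-line _        (here refl) _  = refl
head-line {e} (_∷_ {y = f} r rs) (there q) eq
  with refl ← straight r (m+n≡0⇒m≡0 (turn e f) eq)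
  = trans (head-line rs q (m+n≡0⇒n≡0 (turn e (succ e)) eq)) (line-succ e)

-- Strip the common prefix until one of the edges is the head; from there to the other every step is
-- a `succ`, which keeps the line.
same-line : Staircase es → (p : e ∈ es) (q : f ∈ es) → segment p ≡ segment q → line e ≡ line f
same-line rs (here refl) q           eq = sym (head-line rs q (sym eq))
same-line rs p           (here refl) eq = head-line rs p eq
same-line (_∷_ {x = e} {y = f} r rs) (there p) (there q) eq = same-line rs p q (+-cancelˡ-≡ (turn e f) _ _ eq)

head-last : Staircase (e ∷ es) → (q : f ∈ e ∷ es) → segment q ≡ 0 → succ e ∉ˡ e ∷ es → e ≡ f
head-last _ (here refl) _ _ = refl
head-last {e} (_∷_ {y = g} r rs) (there q) eq e⁺∉ =
  contradiction (there (here (sym (straight r (m+n≡0⇒m≡0 (turn e g) eq))))) e⁺∉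

-- An edge whose `succ` is missing is the last one of its segment. Hence a path and a segment number
-- determine an exit.
last-unique : Staircase es → (p : e ∈ es) (q : f ∈ es) → segment p ≡ segment q →
              succ e ∉ˡ es → succ f ∉ˡ es → e ≡ f
last-unique rs (here refl) q           eq e∉ f∉ = head-last rs q (sym eq) e∉
last-unique rs p           (here refl) eq e∉ f∉ = sym (head-last rs p eq f∉)
last-unique (_∷_ {x = e} {y = f} r rs) (there p) (there q) eq e∉ f∉ =
  last-unique rs p q (+-cancelˡ-≡ (turn e f) _ _ eq) (e∉ ∘ there) (f∉ ∘ there)

-- If `succ f` came later on the first segment, the edge before it there would be `f`.
head-first : Staircase (e ∷ es) → (q : succ f ∈ e ∷ es) → segment q ≡ 0 → f ∉ˡ e ∷ es → e ≡ succ f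
head-first _ (here refl) _ _ = refl
head-first {e} (_∷_ {y = g} r rs) (there q) eq f∉
  with refl ← straight r (m+n≡0⇒m≡0 (turn e g) eq)
  with e⁺≡f⁺ ← head-first rs q (m+n≡0⇒n≡0 (turn e g) eq) (f∉ ∘ there)
  = contradiction (here (sym (succ-injective e⁺≡f⁺))) f∉

first-unique : Staircase es → (p : succ e ∈ es) (q : succ f ∈ es) → segment p ≡ segment q →
               e ∉ˡ es → f ∉ˡ es → e ≡ f
first-unique rs (here refl) q           eq e∉ f∉ = succ-injective (head-first rs q (sym eq) f∉)
first-unique rs p           (here refl) eq e∉ f∉ = sym (succ-injective (head-first rs p eq e∉))
first-unique (_∷_ {x = e} {y = f} r rs) (there p) (there q) eq e∉ f∉ =
  first-unique rs p q (+-cancelˡ-≡ (turn e f) _ _ eq) (e∉ ∘ there) (f∉ ∘ there)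

-- Passing from one path to another along a staircase.

Disjoint : List Edge → List Edge → Set
Disjoint as bs = ∀ {e} → e ∈ as → e ∉ˡ bs

record Exit (bs as : List Edge) : Set where
  constructor exit
  field
    {atEdge}  : Edge
    onPath  : atEdge ∈ bs
    inside  : atEdge ∈ as
    outside : succ atEdge ∉ˡ as

-- `atEdge` is the edge before the one entered: on ℕ × ℕ `succ` is total, a predecessor is not.
record Entrance (bs as : List Edge) : Set where
  constructor entrance
  field
    {atEdge}  : Edge
    onPath  : succ atEdge ∈ bs
    inside  : succ atEdge ∈ as
    outside : atEdge ∉ˡ as

record Corner (bs as as′ : List Edge) : Set where
  constructor corner
  field
    {edge₁ edge₂} : Edge
    step   : edge₁ ↝ edge₂
    bend   : turn edge₁ edge₂ ≡ 1
    onPath : edge₁ ∈ bs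
    on₁    : edge₁ ∈ as
    on₂    : edge₂ ∈ as′

data Passage (bs as as′ : List Edge) : Set where
  leaves : Exit bs as → Passage bs as as′
  enters : Entrance bs as′ → Passage bs as as′
  turns-at : Corner bs as as′ → Passage bs as as′

entrance-there : Entrance bs as → Entrance (e ∷ bs) as
entrance-there (entrance b a a⁺) = entrance (there b) a a⁺

passage-there : Passage bs as as′ → Passage (e ∷ bs) as as′
passage-there (leaves (exit b a a⁺))         = leaves (exit (there b) a a⁺)
passage-there (enters x)                     = enters (entrance-there x)
passage-there (turns-at (corner r t b a a′)) = turns-at (corner r t (there b) a a′)

-- Go straight back from `f` to `e`: either the whole stretch lies in `as`, or the first edge found
-- missing gives an entrance.
straight-entry : Staircase (e ∷ es) → (q : f ∈ e ∷ es) → segment q ≡ 0 → f ∈ as →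
                 e ∈ as ⊎ Entrance (e ∷ es) as
straight-entry rs (here refl) _ f∈as = inj₁ f∈as
straight-entry {e} {as = as} (_∷_ {y = g} r rs) (there q) eq f∈as
  with refl ← straight r (m+n≡0⇒m≡0 (turn e g) eq)
  with straight-entry rs q (m+n≡0⇒n≡0 (turn e g) eq) f∈as | e ∈? as
... | inj₁ e⁺∈ | yes e∈ = inj₁ e∈
... | inj₁ e⁺∈ | no  e∉ = inj₂ (entrance (there (here refl)) e⁺∈ e∉)
... | inj₂ ent | _      = inj₂ (entrance-there ent)

-- Follow the first segment while it stays in `as`. Leaving `as` on it is an exit, and meeting `f`
-- on it contradicts disjointness. Otherwise the turn is reached inside `as`, and `straight-entry`
-- treats the stretch from the turn to `f`.
head-passage : Disjoint as as′ → Staircase (e ∷ es) → (q : f ∈ e ∷ es) → segment q ≤ 1 →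
               e ∈ as → f ∈ as′ → Passage (e ∷ es) as as′
head-passage dis rs (here refl) _ e∈ f∈ = contradiction f∈ (dis e∈)
head-passage {as} {e = e} dis (_∷_ {y = g} r rs) (there q) le e∈ f∈ with turn e g in eq | turn≤1 e g
... | 0 | _ with refl ← straight r eq with succ e ∈? as
...   | yes e⁺∈ = passage-there (head-passage dis rs q le e⁺∈ f∈)
...   | no  e⁺∉ = leaves (exit (here refl) e∈ e⁺∉)
head-passage {e = e} dis (_∷_ {y = g} r rs) (there q) (s≤s le) e∈ f∈ | 1 | _
  with straight-entry rs q (n≤0⇒n≡0 le) f∈
... | inj₁ g∈  = turns-at (corner r eq (here refl) e∈ g∈)
... | inj₂ ent = enters (entrance-there ent)
head-passage _ (_ ∷ _) (there _) _ _ _ | suc (suc _) | s≤s ()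

-- After stripping the common prefix, the walk starts at whichever of `e` and `f` comes first; this
-- decides the direction of the passage.
passage : Disjoint as as′ → Staircase bs → (p : e ∈ bs) (q : f ∈ bs) →
          segment p ≤ suc (segment q) → segment q ≤ suc (segment p) →
          e ∈ as → f ∈ as′ → Passage bs as as′ ⊎ Passage bs as′ as
passage dis rs (here refl) q p≤q q≤p e∈ f∈ = inj₁ (head-passage dis rs q q≤p e∈ f∈)
passage dis rs p (here refl) p≤q q≤p e∈ f∈ = inj₂ (head-passage (λ a b → dis b a) rs p p≤q f∈ e∈)
passage dis (_∷_ {x = e} {y = f} r rs) (there p) (there q) p≤q q≤p e∈ f∈
  with passage dis rs p q (cancel p≤q) (cancel q≤p) e∈ f∈
  where
  cancel : ∀ {a b} → turn e f ℕ.+ a ≤ suc (turn e f ℕ.+ b) → a ≤ suc b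
  cancel {a} {b} le = +-cancelˡ-≤ (turn e f) a (suc b) (≤-trans le (≤-reflexive (sym (+-suc (turn e f) b))))
... | inj₁ x = inj₁ (passage-there x)
... | inj₂ x = inj₂ (passage-there x)

-- Corners are determined by the sum of their segment numbers.

corner-height : (c : Corner bs as as′) → let open Corner c in height edge₂ ≡ suc (height edge₁)
corner-height c = height-↝ (Corner.step c)

-- Two perpendicular lines cross in one point, and `line` also tells which of them is taken first.
corner-determined : e ↝ f → turn e f ≡ 1 → e′ ↝ f′ → turn e′ f′ ≡ 1 → line e ≡ line e′ → line f ≡ line f′ → e ≡ e′
corner-determined right-up _ right-up _ refl refl = refl
corner-determined up-right _ up-right _ refl refl = refl

segment-<⇒height-< : Staircase es → (p : e ∈ es) (q : f ∈ es) → segment p < segment q → height e < height f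
segment-<⇒height-< rs p q lt = ≰⇒> λ ge → <⇒≱ lt (segment-mono rs q p ge)

-- With equal sums, a smaller number on `as` means a larger one on `as′`. So `as` puts `c` below
-- `c′` and `as′` puts it above; `corner-height` makes the two comparisons of heights contradict
-- each other.
corner-ordered : Staircase as → Staircase as′ → ∀ {bs bs′} (c : Corner bs as as′) (c′ : Corner bs′ as as′) →
  let open Corner in segment (on₁ c) ℕ.+ segment (on₂ c) ≡ segment (on₁ c′) ℕ.+ segment (on₂ c′) →
  segment (on₁ c) ≮ segment (on₁ c′)
corner-ordered sa sa′ c c′ eq i<i′ =
  <-asym (segment-<⇒height-< sa (on₁ c) (on₁ c′) i<i′)
    (ℕ.s<s⁻¹ (subst₂ _<_ (corner-height c′) (corner-height c) (segment-<⇒height-< sa′ (on₂ c′) (on₂ c) j′<j)))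
  where
  open Corner
  j′<j : segment (on₂ c′) < segment (on₂ c)
  j′<j = ≰⇒> λ j≤j′ → <⇒≢ (+-mono-<-≤ i<i′ j≤j′) eq

corner-unique : Staircase as → Staircase as′ → ∀ {bs bs′} (c : Corner bs as as′) (c′ : Corner bs′ as as′) →
  let open Corner in segment (on₁ c) ℕ.+ segment (on₂ c) ≡ segment (on₁ c′) ℕ.+ segment (on₂ c′) →
  edge₁ c ≡ edge₁ c′
corner-unique sa sa′ c c′ eq with <-cmp (segment (on₁ c)) (segment (on₁ c′))
  where open Corner
... | tri< i<i′ _ _ = contradiction i<i′ (corner-ordered sa sa′ c c′ eq)
... | tri> _ _ i>i′ = contradiction i>i′ (corner-ordered sa sa′ c′ c (sym eq))
... | tri≈ _ i≡i′ _ = corner-determined (step c) (bend c) (step c′) (bend c′)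
    (same-line sa (on₁ c) (on₁ c′) i≡i′)
    (same-line sa′ (on₂ c) (on₂ c′) (+-cancelˡ-≡ (segment (on₁ c)) _ _ (trans eq (cong (ℕ._+ segment (on₂ c′)) (sym i≡i′)))))
  where open Corner

-- Counting by lists, halves and parities.

length-++-≡ : ∀ {A : Set} (xs : List A) {ys k l} → length xs ≡ k → length ys ≡ l → length (xs ++ ys) ≡ k ℕ.+ l
length-++-≡ xs refl refl = length-++ xs

length-cartesianProductWith : ∀ {A B C : Set} (f : A → B → C) xs ys {k l} →
  length xs ≡ k → length ys ≡ l → length (cartesianProductWith f xs ys) ≡ k * l
length-cartesianProductWith f []       ys refl refl = refl
length-cartesianProductWith f (x ∷ xs) ys refl refl =
  length-++-≡ (map (f x) ys) (length-map (f x) ys) (length-cartesianProductWith f xs ys refl refl)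

length-allFin : ∀ n → length (allFin n) ≡ n
length-allFin n = length-tabulate {n = n} (λ i → i)

-- The pigeonhole principle applied to positions in `L`, so repetitions in `L` only weaken the
-- bound.
list-bound : ∀ {C : Set} (R : Fin n → C → Set) (L : List C) →
             (∀ b → ∃ λ c → c ∈ L × R b c) →
             (∀ {b b′ c} → R b c → R b′ c → b ≡ b′) →
             n ≤ length L
list-bound R L total unique = ≮⇒≥ λ L<n →
  let code b       = proj₁ (total b)
      code∈ b      = proj₁ (proj₂ (total b))
      related b    = proj₂ (proj₂ (total b))
      b , b′ , b<b′ , eq = pigeonhole L<n (index ∘ code∈)
      same : code b ≡ code b′
      same = trans (lookup-index (code∈ b)) (trans (cong (lookup L) eq) (sym (lookup-index (code∈ b′))))
  in <⇒≢ᶠ b<b′ (unique (related b) (subst (R b′) (sym same) (related b′)))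

bit : Parity → ℕ
bit 0ℙ = 0
bit 1ℙ = 1

bit+halves : ∀ s → s ≡ bit (parity s) ℕ.+ (⌊ s /2⌋ ℕ.+ ⌊ s /2⌋)
bit+halves 0             = refl
bit+halves 1             = refl
bit+halves (suc (suc s)) = trans (cong (2 ℕ.+_) (bit+halves s)) (shift (bit (parity s)) ⌊ s /2⌋)
  where
  shift : ∀ b k → 2 ℕ.+ (b ℕ.+ (k ℕ.+ k)) ≡ b ℕ.+ (suc k ℕ.+ suc k)
  shift = solve-∀

halves-equal⇒≤suc : ∀ i j → ⌊ i /2⌋ ≡ ⌊ j /2⌋ → i ≤ suc j
halves-equal⇒≤suc 0 j _ = z≤n
halves-equal⇒≤suc 1 j _ = s≤s z≤n
halves-equal⇒≤suc (suc (suc i)) (suc (suc j)) eq = s≤s (s≤s (halves-equal⇒≤suc i j (suc-injective eq)))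

length-filter-parity : ∀ {A : Set} (p : A → Parity) xs →
  length (filter ((ℙ._≟ 0ℙ) ∘ p) xs) ℕ.+ length (filter ((ℙ._≟ 1ℙ) ∘ p) xs) ≡ length xs
length-filter-parity p []       = refl
length-filter-parity p (x ∷ xs) with p x
... | 0ℙ = cong suc (length-filter-parity p xs)
... | 1ℙ = trans (+-suc _ _) (cong suc (length-filter-parity p xs))

-- The two sides differ by the square of the difference `d` of `k` and `l`.
4kl≤[k+l]² : ∀ k l → 4 * (k * l) ≤ (k ℕ.+ l) * (k ℕ.+ l)
4kl≤[k+l]² k l with ≤-total k l
... | inj₁ k≤l with d , refl ← m≤n⇒∃[o]m+o≡n k≤l = subst (4 * (k * (k ℕ.+ d)) ≤_) (square k d) (m≤m+n _ (d * d))
  where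
  square : ∀ k d → 4 * (k * (k ℕ.+ d)) ℕ.+ d * d ≡ (k ℕ.+ (k ℕ.+ d)) * (k ℕ.+ (k ℕ.+ d))
  square = solve-∀
... | inj₂ l≤k with d , refl ← m≤n⇒∃[o]m+o≡n l≤k = subst (4 * ((l ℕ.+ d) * l) ≤_) (square l d) (m≤m+n _ (d * d))
  where
  square : ∀ l d → 4 * ((l ℕ.+ d) * l) ℕ.+ d * d ≡ (l ℕ.+ d ℕ.+ l) * (l ℕ.+ d ℕ.+ l)
  square = solve-∀

-- Encoding the paths `B b` and counting the codes.

data Code (m : ℕ) : Set where
  exitᶜ entranceᶜ : Fin m → ℕ → Code m
  cornerᶜ         : Fin m → Fin m → ℕ → Code m

-- With m = t + 2, the bound 2m - 3 on bends reads `suc (t + t)` and is also the largest segment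
-- number.
module Counting {t n : ℕ}
  (A : Fin (suc (suc t)) → List Edge) (B : Fin n → List Edge)
  (stairA : ∀ a → Staircase (A a)) (stairB : ∀ b → Staircase (B b))
  (turnsA : ∀ a → turns (A a) ≤ suc (t ℕ.+ t)) (turnsB : ∀ b → turns (B b) ≤ suc (t ℕ.+ t))
  (disjointA : ∀ {a a′} → a ≢ a′ → Disjoint (A a) (A a′))
  (disjointB : ∀ {b b′} → b ≢ b′ → Disjoint (B b) (B b′))
  (meet : ∀ a b → ∃ λ e → e ∈ A a × e ∈ B b)
  where

  m : ℕ
  m = suc (suc t)

  cornerParity : Fin m → Fin m → Parity
  cornerParity a a′ = (initial (A a) ⊕ initial (A a′)) ⁻¹

  -- k enumerates the values of i + j of the parity forced by a and a′.
  cornerCode : Fin m × Fin m → ℕ → Code m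
  cornerCode (a , a′) k = cornerᶜ a a′ (bit (cornerParity a a′) ℕ.+ (k ℕ.+ k))

  startingWith : Parity → List (Fin m)
  startingWith p = filter (λ a → initial (A a) ℙ.≟ p) (allFin m)

  h v : List (Fin m)
  h = startingWith 0ℙ
  v = startingWith 1ℙ

  -- Pairs are ordered because a corner leads from one path to the other. As `punchIn a` runs
  -- through the indices other than `a`, there are m(m - 1) distinct pairs.
  distinctPairs oppositePairs : List (Fin m × Fin m)
  distinctPairs = cartesianProductWith (λ a k → a , punchIn a k) (allFin m) (allFin (suc t))
  oppositePairs = cartesianProduct h v ++ cartesianProduct v h

  segments : List ℕ
  segments = upTo (2 ℕ.+ (t ℕ.+ t))

  -- The value k = 2m − 3 is only reached by pairs starting in opposite directions.
  exits entrances corners extraCorners codes : List (Code m)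
  exits        = cartesianProductWith exitᶜ     (allFin m) segments
  entrances    = cartesianProductWith entranceᶜ (allFin m) segments
  corners      = cartesianProductWith cornerCode distinctPairs (upTo (suc (t ℕ.+ t)))
  extraCorners = map (λ ab → cornerCode ab (suc (t ℕ.+ t))) oppositePairs
  codes        = exits ++ entrances ++ corners ++ extraCorners

  Has : Fin n → Code m → Set
  Has b (exitᶜ a i)      = Σ (Exit (B b) (A a)) λ x → segment (Exit.inside x) ≡ i
  Has b (entranceᶜ a i)  = Σ (Entrance (B b) (A a)) λ x → segment (Entrance.inside x) ≡ i
  Has b (cornerᶜ a a′ s) = Σ (Corner (B b) (A a) (A a′)) λ c → segment (Corner.on₁ c) ℕ.+ segment (Corner.on₂ c) ≡ s

  common⇒≡ : ∀ {b b′ e} → e ∈ B b → e ∈ B b′ → b ≡ b′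
  common⇒≡ {b} {b′} p q with b ≟ᶠ b′
  ... | yes b≡b′ = b≡b′
  ... | no  b≢b′ = contradiction q (disjointB b≢b′ p)

  -- The uniqueness lemma for each kind of event puts both events at the same edge, which then lies
  -- on `B b` and on `B b′`.
  code-unique : ∀ {b b′ c} → Has b c → Has b′ c → b ≡ b′
  code-unique {b′ = b′} {exitᶜ a i} (exit on in₁ out , refl) (exit on′ in′ out′ , eq) =
    common⇒≡ on (subst (_∈ B b′) (last-unique (stairA a) in′ in₁ eq out′ out) on′)
  code-unique {b′ = b′} {entranceᶜ a i} (entrance on in₁ out , refl) (entrance on′ in′ out′ , eq) =
    common⇒≡ on (subst (_∈ B b′) (cong succ (first-unique (stairA a) in′ in₁ eq out′ out)) on′)
  code-unique {b′ = b′} {cornerᶜ a a′ s} (c , refl) (c′ , eq) =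
    common⇒≡ (Corner.onPath c) (subst (_∈ B b′) (corner-unique (stairA a) (stairA a′) c′ c eq) (Corner.onPath c′))

  ∈-distinctPairs : ∀ {a a′} → a ≢ a′ → (a , a′) ∈ distinctPairs
  ∈-distinctPairs {a} a≢a′ = subst (λ x → (a , x) ∈ distinctPairs) (punchIn-punchOut a≢a′)
    (∈-cartesianProductWith⁺ (λ a k → a , punchIn a k) (∈-allFin a) (∈-allFin (punchOut a≢a′)))

  ∈-startingWith : ∀ {a p} → initial (A a) ≡ p → a ∈ startingWith p
  ∈-startingWith {a} {p} eq = ∈-filter⁺ (λ a → initial (A a) ℙ.≟ p) (∈-allFin a) eq

  ∈-oppositePairs : ∀ {a a′} → cornerParity a a′ ≡ 0ℙ → (a , a′) ∈ oppositePairs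
  ∈-oppositePairs {a} {a′} eq with initial (A a) in p | initial (A a′) in q
  ... | 0ℙ | 1ℙ = ∈-++⁺ˡ (∈-cartesianProduct⁺ (∈-startingWith p) (∈-startingWith q))
  ... | 1ℙ | 0ℙ = ∈-++⁺ʳ (cartesianProduct h v) (∈-cartesianProduct⁺ (∈-startingWith p) (∈-startingWith q))

  exit-listed : ∀ {a i} → i ≤ suc (t ℕ.+ t) → exitᶜ a i ∈ codes
  exit-listed {a} i≤ = ∈-++⁺ˡ (∈-cartesianProductWith⁺ exitᶜ (∈-allFin a) (∈-upTo⁺ (s≤s i≤)))

  entrance-listed : ∀ {a i} → i ≤ suc (t ℕ.+ t) → entranceᶜ a i ∈ codes
  entrance-listed {a} i≤ = ∈-++⁺ʳ exits (∈-++⁺ˡ (∈-cartesianProductWith⁺ entranceᶜ (∈-allFin a) (∈-upTo⁺ (s≤s i≤))))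

  corner-listed : ∀ {a a′ s} → a ≢ a′ → parity s ≡ cornerParity a a′ →
                  s ≤ suc (t ℕ.+ t) ℕ.+ suc (t ℕ.+ t) → cornerᶜ a a′ s ∈ codes
  corner-listed {a} {a′} {s} a≢a′ par s≤ = subst (λ x → cornerᶜ a a′ x ∈ codes) (sym s≡)
    (∈-++⁺ʳ exits (∈-++⁺ʳ entrances member))
    where
    k = ⌊ s /2⌋
    s≡ : s ≡ bit (cornerParity a a′) ℕ.+ (k ℕ.+ k)
    s≡ = trans (bit+halves s) (cong (λ p → bit p ℕ.+ (k ℕ.+ k)) par)
    k≤ : k ≤ suc (t ℕ.+ t)
    k≤ = subst (k ≤_) (sym (n≡⌊n+n/2⌋ _)) (⌊n/2⌋-mono s≤)
    -- For this `k` an odd `s` would be 4t + 3, but two segment numbers add up to at most 4t + 2.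
    even : k ≡ suc (t ℕ.+ t) → cornerParity a a′ ≡ 0ℙ
    even k≡ with cornerParity a a′ | s≡
    ... | 0ℙ | _  = refl
    ... | 1ℙ | eq = contradiction (≤-trans (≤-reflexive (sym eq)) (subst (λ x → s ≤ x ℕ.+ x) (sym k≡) s≤)) (<⇒≱ ≤-refl)
    member : cornerCode (a , a′) k ∈ corners ++ extraCorners
    member with m≤n⇒m<n∨m≡n k≤
    ... | inj₁ k< = ∈-++⁺ˡ (∈-cartesianProductWith⁺ cornerCode (∈-distinctPairs a≢a′) (∈-upTo⁺ k<))
    ... | inj₂ k≡ = ∈-++⁺ʳ corners (subst (λ x → cornerCode (a , a′) x ∈ extraCorners) (sym k≡)
                      (∈-map⁺ (λ ab → cornerCode ab (suc (t ℕ.+ t))) (∈-oppositePairs (even k≡))))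

  segmentA≤ : ∀ {a e} (p : e ∈ A a) → segment p ≤ suc (t ℕ.+ t)
  segmentA≤ {a} p = ≤-trans (segment≤turns p) (turnsA a)

  -- By `segment-parity` the sum has the parity of the two initial directions plus the directions of
  -- the two edges; the latter differ at a bend and contribute 1.
  corner-parity : ∀ {a a′ bs} (c : Corner bs (A a) (A a′)) →
    parity (segment (Corner.on₁ c) ℕ.+ segment (Corner.on₂ c)) ≡ cornerParity a a′
  corner-parity {a} {a′} (corner {e} {f} step bend _ p q)
    rewrite ℙ.+-homo-+ (segment p) (segment q) | segment-parity p | segment-parity q
    = flip (initial (A a)) (initial (A a′)) (direction e) (direction f) (trans (sym (turn-parity e f)) (cong parity bend))
    where
    flip : ∀ p q d d′ → d ⊕ d′ ≡ 1ℙ → (p ⊕ d) ⊕ (q ⊕ d′) ≡ (p ⊕ q) ⁻¹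
    flip 0ℙ 0ℙ 0ℙ 1ℙ _ = refl
    flip 0ℙ 0ℙ 1ℙ 0ℙ _ = refl
    flip 0ℙ 1ℙ 0ℙ 1ℙ _ = refl
    flip 0ℙ 1ℙ 1ℙ 0ℙ _ = refl
    flip 1ℙ 0ℙ 0ℙ 1ℙ _ = refl
    flip 1ℙ 0ℙ 1ℙ 0ℙ _ = refl
    flip 1ℙ 1ℙ 0ℙ 1ℙ _ = refl
    flip 1ℙ 1ℙ 1ℙ 0ℙ _ = refl

  passage-code : ∀ {a a′ b} → a ≢ a′ → Passage (B b) (A a) (A a′) → ∃ λ c → c ∈ codes × Has b c
  passage-code _    (leaves x)   = _ , exit-listed (segmentA≤ (Exit.inside x)) , x , refl
  passage-code _    (enters x)   = _ , entrance-listed (segmentA≤ (Entrance.inside x)) , x , refl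
  passage-code a≢a′ (turns-at c) = _ , corner-listed a≢a′ (corner-parity c)
    (+-mono-≤ (segmentA≤ (Corner.on₁ c)) (segmentA≤ (Corner.on₂ c))) , c , refl

  coded : ∀ b → ∃ λ c → c ∈ codes × Has b c
  coded b =
    let seg a        = segment (proj₂ (proj₂ (meet a b)))
        -- Segments 2k and 2k + 1 of `B b` form one class. The numbers 0 to 2t + 1 give t + 1 = m -
        -- 1 classes for m paths, so two of these share a class.
        half< a      = s≤s (subst (⌊ seg a /2⌋ ≤_) (half-odd t) (⌊n/2⌋-mono (≤-trans (segment≤turns (proj₂ (proj₂ (meet a b)))) (turnsB b))))
        a , a′ , a<a′ , eq = pigeonhole {m = suc t} ≤-refl (λ a → fromℕ< (half< a))
        half≡ : ⌊ seg a /2⌋ ≡ ⌊ seg a′ /2⌋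
        half≡ = trans (sym (toℕ-fromℕ< (half< a))) (trans (cong toℕ eq) (toℕ-fromℕ< (half< a′)))
        a≢a′         = <⇒≢ᶠ a<a′
        e , e∈a , e∈b     = meet a b
        f , f∈a′ , f∈b    = meet a′ b
    in either a≢a′ (passage (disjointA a≢a′) (stairB b) e∈b f∈b
         (halves-equal⇒≤suc _ _ half≡) (halves-equal⇒≤suc _ _ (sym half≡)) e∈a f∈a′)
    where
    half-odd : ∀ t → ⌊ suc (t ℕ.+ t) /2⌋ ≡ t
    half-odd 0       = refl
    half-odd (suc t) = cong suc (trans (cong ⌊_/2⌋ (+-suc t t)) (half-odd t))
    either : ∀ {a a′} → a ≢ a′ → Passage (B b) (A a) (A a′) ⊎ Passage (B b) (A a′) (A a) → ∃ λ c → c ∈ codes × Has b c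
    either a≢a′ (inj₁ x) = passage-code a≢a′ x
    either a≢a′ (inj₂ x) = passage-code (a≢a′ ∘ sym) x

  length-codes : length codes ≡
    m * (2 ℕ.+ (t ℕ.+ t)) ℕ.+ (m * (2 ℕ.+ (t ℕ.+ t)) ℕ.+
    (m * suc t * suc (t ℕ.+ t) ℕ.+ (length h * length v ℕ.+ length v * length h)))
  length-codes =
    length-++-≡ exits (length-cartesianProductWith exitᶜ (allFin m) segments (length-allFin m) (length-upTo (2 ℕ.+ (t ℕ.+ t))))
    (length-++-≡ entrances (length-cartesianProductWith entranceᶜ (allFin m) segments (length-allFin m) (length-upTo (2 ℕ.+ (t ℕ.+ t))))
    (length-++-≡ corners
      (length-cartesianProductWith cornerCode distinctPairs (upTo (suc (t ℕ.+ t)))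
        (length-cartesianProductWith (λ a k → a , punchIn a k) (allFin m) (allFin (suc t)) (length-allFin m) (length-allFin (suc t)))
        (length-upTo (suc (t ℕ.+ t))))
      (trans (length-map _ oppositePairs)
        (length-++-≡ (cartesianProduct h v)
          (length-cartesianProductWith _,_ h v refl refl) (length-cartesianProductWith _,_ v h refl refl)))))

  -- This is n ≤ 2m³ - m²/2 - m, doubled and free of subtraction.
  n-bound : 2 * n ℕ.+ (m * m ℕ.+ 2 * m) ≤ 4 * m ^ 3
  n-bound = begin
    2 * n ℕ.+ (m * m ℕ.+ 2 * m)             ≤⟨ +-monoˡ-≤ _ (*-monoʳ-≤ 2 (list-bound Has codes coded code-unique)) ⟩
    2 * length codes ℕ.+ (m * m ℕ.+ 2 * m)  ≡⟨ cong (λ x → 2 * x ℕ.+ (m * m ℕ.+ 2 * m)) length-codes ⟩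
    _                                       ≡⟨ collect (m * (2 ℕ.+ (t ℕ.+ t))) (m * suc t * suc (t ℕ.+ t)) (length h) (length v) (m * m ℕ.+ 2 * m) ⟩
    4 * (length h * length v) ℕ.+ rest      ≤⟨ +-monoˡ-≤ _ (4kl≤[k+l]² (length h) (length v)) ⟩
    (length h ℕ.+ length v) * (length h ℕ.+ length v) ℕ.+ rest  ≡⟨ cong (λ x → x * x ℕ.+ rest) (trans (length-filter-parity (initial ∘ A) (allFin m)) (length-allFin m)) ⟩
    m * m ℕ.+ rest                          ≡⟨ cube t ⟩
    4 * m ^ 3                               ∎
    where
    open ≤-Reasoning
    rest : ℕ
    rest = 2 * (2 * (m * (2 ℕ.+ (t ℕ.+ t))) ℕ.+ m * suc t * suc (t ℕ.+ t)) ℕ.+ (m * m ℕ.+ 2 * m)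
    collect : ∀ a b k l c → 2 * (a ℕ.+ (a ℕ.+ (b ℕ.+ (k * l ℕ.+ l * k)))) ℕ.+ c ≡ 4 * (k * l) ℕ.+ (2 * (2 * a ℕ.+ b) ℕ.+ c)
    collect = solve-∀
    cube : ∀ t → (2 ℕ.+ t) * (2 ℕ.+ t) ℕ.+ (2 * (2 * ((2 ℕ.+ t) * (2 ℕ.+ (t ℕ.+ t))) ℕ.+ (2 ℕ.+ t) * (1 ℕ.+ t) * (1 ℕ.+ (t ℕ.+ t)))
                 ℕ.+ ((2 ℕ.+ t) * (2 ℕ.+ t) ℕ.+ 2 * (2 ℕ.+ t))) ≡ 4 * ((2 ℕ.+ t) * ((2 ℕ.+ t) * ((2 ℕ.+ t) * 1)))
    cube = solve-∀

-- From the rational hypothesis to natural numbers, and the theorem.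

clear-denominators : ∀ X c m n →
  (+ n / 1) ≥ℚ (+ X / 1 - + c / 2 - + m / 1 + 1ℚᵘ) → 2 * X ℕ.+ 2 ≤ 2 * n ℕ.+ (c ℕ.+ 2 * m)
clear-denominators X c m n le = ℤ.drop‿+≤+ (begin
  + (2 * X ℕ.+ 2)                                                      ≡⟨ cong (ℤ._+ + 2) (ℤ.pos-* 2 X) ⟩
  + 2 ℤ.* + X ℤ.+ + 2                                                  ≡⟨ expand (+ X) (+ c) (+ m) ⟩
  ↥ (+ X / 1 - + c / 2 - + m / 1 + 1ℚᵘ) ℤ.* + 1 ℤ.+ (+ c ℤ.+ + 2 ℤ.* + m)  ≤⟨ ℤ.+-monoˡ-≤ (+ c ℤ.+ + 2 ℤ.* + m) (drop-*≤* le) ⟩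
  + n ℤ.* + 2 ℤ.+ (+ c ℤ.+ + 2 ℤ.* + m)                                ≡⟨ cong₂ ℤ._+_ (trans (ℤ.*-comm (+ n) (+ 2)) (sym (ℤ.pos-* 2 n))) (cong (λ i → + c ℤ.+ i) (sym (ℤ.pos-* 2 m))) ⟩
  + (2 * n ℕ.+ (c ℕ.+ 2 * m))                                          ∎)
  where
  open ℤ.≤-Reasoning
  -- The right-hand side spells out the numerator, over the denominator 2, to which the unnormalised
  -- rational expression computes.
  expand : ∀ X c m → + 2 ℤ.* X ℤ.+ + 2 ≡
    (((X ℤ.* + 2 ℤ.+ ℤ.- c ℤ.* + 1) ℤ.* + 1 ℤ.+ ℤ.- m ℤ.* + 2) ℤ.* + 1 ℤ.+ + 1 ℤ.* + 2) ℤ.* + 1 ℤ.+ (c ℤ.+ + 2 ℤ.* m)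
  expand = solveℤ-∀

theorem2p8 : (m : ℕ) → m ≥ 3 → (n : ℕ) →
    (+ n / 1) ≥ℚ (+ (2 * m ^ 3) / 1 - + (m ^ 2) / 2 - + m / 1 + 1ℚᵘ) →
    K m n ∉ Bᵐ (2 * m ∸ 3)
theorem2p8 m@(suc (suc t)) (s≤s (s≤s _)) n large (R , mono) = <⇒≱ (too-large (clear-denominators (2 * m ^ 3) (m ^ 2) m n large)) n-bound
  where
  open EPGRepresentation R
  A : Fin m → List Edge
  A a = edges (path (inj₁ a))
  B : Fin n → List Edge
  B b = edges (path (inj₂ b))
  staircase : ∀ w → Staircase (edges (path w))
  staircase w = edges-staircase (path w) (proj₁ (mono w))
  bends≤ : ∀ w → bends (path w) ≤ suc (t ℕ.+ t)
  -- Once 2m is written as 4 + (t + t), the truncated subtraction computes to `suc (t + t)`.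
  bends≤ w = ≤-trans (proj₂ (mono w)) (≤-reflexive (cong (_∸ 3) (double t)))
    where
    double : ∀ t → 2 * suc (suc t) ≡ 4 ℕ.+ (t ℕ.+ t)
    double = solve-∀
  disjoint : ∀ {w w′} → w ≢ w′ → ¬ Graph.Adj (K m n) w w′ → Disjoint (edges (path w)) (edges (path w′))
  disjoint w≢w′ ¬adj p q = ¬adj (Equivalence.from (adj⇔share w≢w′) (_ , p , q))
  n-bound : 2 * n ℕ.+ (m * m ℕ.+ 2 * m) ≤ 4 * m ^ 3
  n-bound = Counting.n-bound A B (staircase ∘ inj₁) (staircase ∘ inj₂) (bends≤ ∘ inj₁) (bends≤ ∘ inj₂)
    (λ a≢a′ → disjoint (a≢a′ ∘ inj₁-injective) λ ())
    (λ b≢b′ → disjoint (b≢b′ ∘ inj₂-injective) λ ())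
    (λ a b → Equivalence.to (adj⇔share λ ()) tt)
  too-large : 2 * (2 * m ^ 3) ℕ.+ 2 ≤ 2 * n ℕ.+ (m ^ 2 ℕ.+ 2 * m) → 4 * m ^ 3 < 2 * n ℕ.+ (m * m ℕ.+ 2 * m)
  too-large le = begin-strict
    4 * m ^ 3                          <⟨ m<m+n (4 * m ^ 3) (s≤s z≤n) ⟩
    4 * m ^ 3 ℕ.+ 2                    ≡⟨ cong (ℕ._+ 2) (*-assoc 2 2 (m ^ 3)) ⟩
    2 * (2 * m ^ 3) ℕ.+ 2              ≤⟨ le ⟩
    2 * n ℕ.+ (m ^ 2 ℕ.+ 2 * m)        ≡⟨ cong (λ x → 2 * n ℕ.+ (m * x ℕ.+ 2 * m)) (*-identityʳ m) ⟩
    2 * n ℕ.+ (m * m ℕ.+ 2 * m)        ∎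
    where open ≤-Reasoning
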